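{- For each positive integer $n$, let $$F=F(X,Y)=\sum_{0\le i,j\le n}\varepsilon_{i,j}X^iY^j$$ be a random bivariate polynomial whose $(n+1)^2$ coefficients $\varepsilon_{i,j}$ are chosen independently and uniformly at random from $\{0,1,-1\}$. Then $$\lim_{n\to\infty}\mathbb{P}(F\ \text{is reducible})=0.$$
   Context: Reducible means reducible over $\mathbb{Z}[X,Y]$, i.e. $F=GH$ for some non-constant $G,H\in\mathbb{Z}[X,Y]$. Equivalently, the probability is the number of reducible polynomials among the $3^{(n+1)^2}$ polynomials $\sum_{0\le i,j\le n}\varepsilon_{i,j}X^iY^j$ with all $\varepsilon_{i,j}\in\{0,1,-1\}$, divided by $3^{(n+1)^2}$. -}

module Defs where

open import Data.Nat using (ℕ; zero; suc; _+_; _*_; _∸_; _^_; _≤_; s≤s; _<_; _<?_)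
open import Data.Nat.Properties
  using (m^n≢0; ≮⇒≥; ≤-<-trans; <-≤-trans; ≤-reflexive; +-monoˡ-≤; +-cancelˡ-<; m+[n∸m]≡n)
open import Data.Integer as ℤ using (ℤ; +_; 0ℤ; 1ℤ; -1ℤ)
import Data.Integer.Properties as ℤ
open import Data.Rational using (ℚ; _/_)
open import Data.Fin as Fin using (Fin; toℕ)
open import Data.Fin.Patterns using (0F; 1F; 2F)
open import Data.Fin.Properties using (toℕ≤pred[n])
open import Data.Vec using (Vec; []; _∷_; replicate)
import Data.Vec.Properties as Vec
open import Data.List as List using (List; length; cartesianProductWith; deduplicate; allFin)
open import Data.List.Membership.Propositional using (_∈_)
open import Data.List.Membership.Propositional.Properties
  using (∈-allFin; ∈-cartesianProductWith⁺; ∈-deduplicate⁺; ∈-deduplicate⁻)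
open import Data.List.Membership.Propositional.Properties.WithK using (unique∧set⇒bag)
open import Data.List.Relation.Unary.Any using (here; there)
open import Data.List.Relation.Unary.Unique.Propositional using (Unique)
open import Data.List.Relation.Unary.Unique.DecPropositional.Properties using (deduplicate-!)
open import Data.List.Relation.Binary.BagAndSetEquality using (∼bag⇒↭)
open import Data.List.Relation.Binary.Permutation.Propositional.Properties using (↭-length)
open import Data.Product using (∃-syntax; ∃₂; _×_; _,_; proj₂)
open import Data.Empty using (⊥-elim)
open import Function using (_⇔_; mk⇔; Equivalence)
open import Function.Properties.Equivalence using () renaming (sym to ⇔-sym; trans to ⇔-trans)
open import Level using (0ℓ)
open import Relation.Binary using (DecidableEquality)
open import Relation.Binary.PropositionalEquality using (_≡_; refl; sym; trans; cong)
open import Relation.Nullary using (¬_; yes; no)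
open import Relation.Unary using (Pred)

open import Algebra.Properties.CommutativeMonoid.Sum ℤ.+-0-commutativeMonoid
  using (sum⁺-syntax; sum-cong-≗; sum-replicate-zero)

-- coeff i j is the coefficient of X^i Y^j.  The bound on the exponents is a
-- witness of finite support only: it need not be sharp, and _≈_ ignores it.
record ℤ[X,Y] : Set where
  field
    coeff   : ℕ → ℕ → ℤ
    bound   : ℕ
    boundˣ  : ∀ i j → bound < i → coeff i j ≡ 0ℤ
    boundʸ  : ∀ i j → bound < j → coeff i j ≡ 0ℤ

open ℤ[X,Y] public

infix 4 _≈_
_≈_ : ℤ[X,Y] → ℤ[X,Y] → Set
F ≈ G = ∀ i j → coeff F i j ≡ coeff G i j

private
  overflow : ∀ {m n i a} → m + n < i → ¬ (m < a) → a ≤ i → n < i ∸ a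
  overflow {m} {n} {i} {a} m+n<i m≮a a≤i = +-cancelˡ-< a n (i ∸ a)
    (≤-<-trans (+-monoˡ-≤ n (≮⇒≥ m≮a))
      (<-≤-trans m+n<i (≤-reflexive (sym (m+[n∸m]≡n a≤i)))))

  sum-zero : ∀ n (t : Fin (suc n) → ℤ) → (∀ a → t a ≡ 0ℤ) → ∑[ a ≤ n ] t a ≡ 0ℤ
  sum-zero n t t≡0 = trans (sum-cong-≗ t≡0) (sum-replicate-zero (suc n))

  product-zero : ∀ (x y : ℤ) {m n i} (a : Fin (suc i)) → m + n < i →
                 (m < toℕ a → x ≡ 0ℤ) → (n < i ∸ toℕ a → y ≡ 0ℤ) → x ℤ.* y ≡ 0ℤ
  product-zero x y {m} a m+n<i x≡0 y≡0 with m <? toℕ a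
  ... | yes m<a = cong (ℤ._* y) (x≡0 m<a)
  ... | no  m≮a = trans (cong (x ℤ.*_) (y≡0 (overflow m+n<i m≮a (toℕ≤pred[n] a))))
                        (ℤ.*-zeroʳ x)

infixl 7 _·_
_·_ : ℤ[X,Y] → ℤ[X,Y] → ℤ[X,Y]
(G · H) .coeff i j =
  ∑[ a ≤ i ] ∑[ b ≤ j ] (coeff G (toℕ a) (toℕ b) ℤ.* coeff H (i ∸ toℕ a) (j ∸ toℕ b))
(G · H) .bound = bound G + bound H
(G · H) .boundˣ i j big = sum-zero i _ λ a → sum-zero j _ λ b →
  product-zero (coeff G (toℕ a) (toℕ b)) (coeff H (i ∸ toℕ a) (j ∸ toℕ b)) a big
    (boundˣ G (toℕ a) (toℕ b)) (boundˣ H (i ∸ toℕ a) (j ∸ toℕ b))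
(G · H) .boundʸ i j big = sum-zero i _ λ a → sum-zero j _ λ b →
  product-zero (coeff G (toℕ a) (toℕ b)) (coeff H (i ∸ toℕ a) (j ∸ toℕ b)) b big
    (boundʸ G (toℕ a) (toℕ b)) (boundʸ H (i ∸ toℕ a) (j ∸ toℕ b))

constant : ℤ → ℤ[X,Y]
constant c .coeff zero zero    = c
constant c .coeff zero (suc _) = 0ℤ
constant c .coeff (suc _) _    = 0ℤ
constant c .bound = 0
constant c .boundˣ (suc _) zero    _ = refl
constant c .boundˣ (suc _) (suc _) _ = refl
constant c .boundʸ zero    (suc _) _ = refl
constant c .boundʸ (suc _) (suc _) _ = refl

NonConstant : ℤ[X,Y] → Set
NonConstant G = ¬ (∃[ c ] G ≈ constant c)

Reducible : ℤ[X,Y] → Set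
Reducible F = ∃₂ λ G H → NonConstant G × NonConstant H × F ≈ G · H

ε-value : Fin 3 → ℤ
ε-value 0F = 0ℤ
ε-value 1F = 1ℤ
ε-value 2F = -1ℤ

-- The sample space: the entry of ω in row i and column j encodes ε_{i,j}.
Ω : ℕ → Set
Ω n = Vec (Vec (Fin 3) (suc n)) (suc n)

lookupOr : ∀ {A : Set} {m} → A → Vec A m → ℕ → A
lookupOr d []       _       = d
lookupOr d (x ∷ xs) zero    = x
lookupOr d (x ∷ xs) (suc i) = lookupOr d xs i

private
  lookupOr-overflow : ∀ {A : Set} {m} (d : A) (xs : Vec A m) i →
                      m ≤ i → lookupOr d xs i ≡ d
  lookupOr-overflow d []       i       _                  = refl
  lookupOr-overflow d (x ∷ xs) (suc i) (s≤s m≤i) = lookupOr-overflow d xs i m≤i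

  lookupOr-replicate : ∀ {A : Set} m (d : A) i → lookupOr d (replicate m d) i ≡ d
  lookupOr-replicate zero    d i       = refl
  lookupOr-replicate (suc m) d zero    = refl
  lookupOr-replicate (suc m) d (suc i) = lookupOr-replicate m d i

-- Σ_{0≤i,j≤n} ε_{i,j} X^i Y^j; the default code 0F stands for the coefficient 0.
polynomial : ∀ {n} → Ω n → ℤ[X,Y]
polynomial {n} ω .coeff i j =
  ε-value (lookupOr 0F (lookupOr (replicate (suc n) 0F) ω i) j)
polynomial {n} ω .bound = n
polynomial {n} ω .boundˣ i j n<i = cong ε-value (trans
  (cong (λ row → lookupOr 0F row j) (lookupOr-overflow _ ω i n<i))
  (lookupOr-replicate (suc n) 0F j))
polynomial {n} ω .boundʸ i j n<j = cong ε-value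
  (lookupOr-overflow 0F (lookupOr (replicate (suc n) 0F) ω i) j n<j)

Event : ℕ → Set₁
Event n = Pred (Ω n) 0ℓ

-- "p is the probability of E": the number of outcomes in E, counted by a
-- duplicate-free enumeration, divided by 3^((n+1)²).  This is a relation, since
-- computing p as a function of E would require deciding E.  It determines p,
-- and some such p exists up to double negation; see the two lemmas below.
HasProbability : ∀ n → Event n → ℚ → Set
HasProbability n E p =
  ∃[ outcomes ] Unique outcomes
              × (∀ (ω : Ω n) → ω ∈ outcomes ⇔ E ω)
              × p ≡ _/_ (+ length outcomes) (3 ^ (suc n * suc n))
                        ⦃ m^n≢0 3 (suc n * suc n) ⦄

HasProbability-unique : ∀ {n E p q} →
                        HasProbability n E p → HasProbability n E q → p ≡ q
HasProbability-unique {n} (xs , xs! , xs⇔E , refl) (ys , ys! , ys⇔E , refl) =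
  cong (λ k → _/_ (+ k) (3 ^ (suc n * suc n)) ⦃ m^n≢0 3 (suc n * suc n) ⦄)
    (↭-length (∼bag⇒↭ (unique∧set⇒bag xs! ys! λ {ω} →
      ⇔-trans (xs⇔E ω) (⇔-sym (ys⇔E ω)))))

private
  allVecs : ∀ {A : Set} → List A → ∀ m → List (Vec A m)
  allVecs xs zero    = [] List.∷ List.[]
  allVecs xs (suc m) = cartesianProductWith _∷_ xs (allVecs xs m)

  ∈-allVecs : ∀ {A : Set} {xs : List A} → (∀ x → x ∈ xs) →
              ∀ {m} (v : Vec A m) → v ∈ allVecs xs m
  ∈-allVecs x∈xs []      = here refl
  ∈-allVecs x∈xs (x ∷ v) = ∈-cartesianProductWith⁺ _∷_ (x∈xs x) (∈-allVecs x∈xs v)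

  _≟_ : ∀ {n} → DecidableEquality (Ω n)
  _≟_ = Vec.≡-dec (Vec.≡-dec Fin._≟_)

  ¬¬-filter : ∀ {A : Set} (P : Pred A 0ℓ) (xs : List A) →
              ¬ ¬ (∃[ ys ] (∀ x → x ∈ ys ⇔ (x ∈ xs × P x)))
  ¬¬-filter P List.[] k = k (List.[] , λ x → mk⇔ (λ ()) λ ())
  ¬¬-filter P (x List.∷ xs) k = ¬¬-filter P xs λ (ys , ys⇔) →
    let absent : ¬ P x
        absent px = k (x List.∷ ys , λ z → mk⇔
          (λ { (here refl) → here refl , px
             ; (there z∈ys) → let z∈xs , pz = Equivalence.to (ys⇔ z) z∈ys
                              in there z∈xs , pz })
          (λ { (here refl , _) → here refl
             ; (there z∈xs , pz) → there (Equivalence.from (ys⇔ z) (z∈xs , pz)) }))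
    in k (ys , λ z → mk⇔
      (λ z∈ys → let z∈xs , pz = Equivalence.to (ys⇔ z) z∈ys in there z∈xs , pz)
      (λ { (here refl , px) → ⊥-elim (absent px)
         ; (there z∈xs , pz) → Equivalence.from (ys⇔ z) (z∈xs , pz) }))

HasProbability-¬¬exists : ∀ n E → ¬ ¬ (∃[ p ] HasProbability n E p)
HasProbability-¬¬exists n E k =
  ¬¬-filter E (allVecs (allVecs (allFin 3) (suc n)) (suc n)) λ (ys , ys⇔) →
    k (_ , deduplicate _≟_ ys , deduplicate-! _≟_ ys ,
       (λ ω → mk⇔
         (λ ω∈ → proj₂ (Equivalence.to (ys⇔ ω) (∈-deduplicate⁻ _≟_ ys ω∈)))
         (λ e → ∈-deduplicate⁺ _≟_
           (Equivalence.from (ys⇔ ω) (∈-allVecs (∈-allVecs ∈-allFin) ω , e)))) ,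
       refl)

-- All coefficients of F lie in {0, 1, -1}, so F is determined by its reduction
-- modulo 3, which is uniform over 𝔽₃.  If F = G H with G of degrees (a, b) in X and
-- Y, then H has degrees at most (n - a, n - b), and modulo 3 there are at most
-- 3^{(a+1)(b+1) + (n-a+1)(n-b+1)} such products.  This exponent is
-- (n+1)² + 1 - (a(n-b) + (n-a)b), and the subtracted term is at least n
-- unless (a, b) is (0, 0) or (n, n), where G or H is constant over ℤ (taking the
-- degrees over ℤ avoids any degree drop modulo 3).  Summing over (a, b), the
-- probability is at most 3 (n+1)² / 3^n ≤ 9 / (n+1).

module Submission where

open import Defs
open import Data.Nat using (ℕ; _≤_)
open import Data.Rational using (ℚ; 0ℚ; _-_; ∣_∣; _<_)
open import Data.Product using (∃-syntax)

open import Data.Nat as ℕ using (zero; suc; z≤n; s≤s; _∸_; _^_)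
import Data.Nat.Properties as ℕ
import Data.Nat.Tactic.RingSolver as ℕ-Solver
open import Data.Integer as ℤ using (ℤ; +_; -[1+_]; 0ℤ; -1ℤ)
import Data.Integer.Properties as ℤ
import Data.Integer.Tactic.RingSolver as ℤ-Solver
open import Data.Integer.DivMod using (_%ℕ_; _/ℕ_; n%ℕd<d; a≡a%ℕn+[a/ℕn]*n)
open import Data.Integer.Divisibility.Signed using (_∣_; divides; _∣?_; ∣m∣n⇒∣m+n; ∣n⇒∣m*n; ∣m⇒∣m*n)
open import Data.Fin as Fin using (Fin; toℕ; fromℕ<; punchIn)
open import Data.Fin.Patterns using (0F; 1F; 2F)
open import Data.Fin.Properties using (toℕ-fromℕ<; toℕ-injective; punchInᵢ≢i)
open import Data.Vec using (Vec; []; _∷_; tabulate; replicate)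
open import Data.Vec.Properties using (tabulate-cong)
open import Data.List as List using (List; length; _++_; map; concatMap; filter; upTo; allFin;
                                    cartesianProductWith; cartesianProduct)
open import Data.List.Properties using (length-++; length-map; length-++-sucʳ; length-upTo; length-filter)
open import Data.List.Membership.Propositional using (_∈_; lose)
open import Data.List.Membership.Propositional.Properties
  using (∈-∃++; ∈-++⁺ˡ; ∈-++⁺ʳ; ∈-++⁻; ∈-allFin; ∈-upTo⁺; ∈-upTo⁻; ∈-filter⁺; ∈-filter⁻; ∈-concatMap⁺;
         ∈-cartesianProductWith⁺; ∈-cartesianProduct⁺; ∈-cartesianProduct⁻)
open import Data.List.Relation.Unary.Any using (here; there)
open import Data.List.Relation.Unary.All as All using ()
open import Data.List.Relation.Unary.Unique.Propositional using (Unique)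
open import Data.List.Relation.Unary.AllPairs using () renaming (_∷_ to _∷ᵘ_)
open import Data.Product using (∃; ∃₂; _×_; _,_)
open import Data.Sum using (_⊎_; inj₁; inj₂)
open import Data.Rational using (_/_; mkℚ; ↧ₙ_; *<*)
import Data.Rational.Properties as ℚ
import Data.Rational.Unnormalised as ℚᵘ
import Data.Rational.Unnormalised.Properties as ℚᵘ
open import Function using (_∘_; Equivalence)
open import Relation.Binary using (tri<; tri≈; tri>)
open import Relation.Binary.PropositionalEquality
  using (_≡_; _≢_; refl; sym; trans; cong; cong₂; subst; subst₂; module ≡-Reasoning)
open import Relation.Nullary using (¬_; yes; no; contradiction)
open import Relation.Nullary.Decidable using (from-no; decidable-stable; ¬?)
open import Relation.Unary using (Decidable)
open import Algebra.Properties.CommutativeMonoid.Sum ℤ.+-0-commutativeMonoid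
  using (sum; sum-remove; sum-cong-≗; sum-replicate-zero; ∑-comm)

-- Leading monomials

greatest : {P : ℕ → Set} → Decidable P → ∀ m → (∀ i → m ≤ i → ¬ P i) →
           (∀ i → ¬ P i) ⊎ (∃ λ a → P a × (∀ i → a ℕ.< i → ¬ P i))
greatest P? zero    none = inj₁ λ i → none i z≤n
greatest {P} P? (suc m) none with P? m
... | yes p = inj₂ (m , p , none)
... | no ¬p = greatest P? m below
  where
  below : ∀ i → m ≤ i → ¬ P i
  below i m≤i with ℕ.m≤n⇒m<n∨m≡n m≤i
  ... | inj₁ m<i  = none i m<i
  ... | inj₂ refl = ¬p

-- X^a Y^b is the leading monomial of G for the lexicographic order with X > Y.
record Leading (G : ℤ[X,Y]) (a b : ℕ) : Set where
  field
    nonzero : coeff G a b ≢ 0ℤ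
    aboveˣ  : ∀ i j → a ℕ.< i → coeff G i j ≡ 0ℤ
    aboveʸ  : ∀ j → b ℕ.< j → coeff G a j ≡ 0ℤ

open Leading

-- Restricting the column to the support bound makes the search finite, hence the property
-- decidable.
NonzeroRow : ℤ[X,Y] → ℕ → Set
NonzeroRow G i = ∃ λ j → j ℕ.< suc (bound G) × coeff G i j ≢ 0ℤ

nonzeroRow? : ∀ G → Decidable (NonzeroRow G)
nonzeroRow? G i = ℕ.anyUpTo? (λ j → ¬? (coeff G i j ℤ.≟ 0ℤ)) (suc (bound G))

zero-row : ∀ {G i} → ¬ NonzeroRow G i → ∀ j → coeff G i j ≡ 0ℤ
zero-row {G} {i} none j with j ℕ.<? suc (bound G)
... | yes j≤ = decidable-stable (coeff G i j ℤ.≟ 0ℤ) λ ≢0 → none (j , j≤ , ≢0)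
... | no  j≰ = boundʸ G i j (ℕ.≮⇒≥ j≰)

-- Take the greatest nonzero row and, inside it, the greatest nonzero column. Nonconstancy serves to
-- exclude the zero polynomial.
leading : ∀ G → NonConstant G → ∃₂ (Leading G)
leading G G-nc with greatest (nonzeroRow? G) (suc (bound G)) (λ i big (j , _ , ≢0) → ≢0 (boundˣ G i j big))
... | inj₁ none = contradiction (0ℤ , G≈0) G-nc
  where
  G≈0 : G ≈ constant 0ℤ
  G≈0 zero    zero    = zero-row {G} (none 0) 0
  G≈0 zero    (suc j) = zero-row {G} (none 0) (suc j)
  G≈0 (suc i) j       = zero-row {G} (none (suc i)) j
... | inj₂ (a , (j , _ , ≢0) , above)
    with greatest (λ j → ¬? (coeff G a j ℤ.≟ 0ℤ)) (suc (bound G)) (λ j big ≢0 → ≢0 (boundʸ G a j big))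
... | inj₁ none = contradiction ≢0 (none j)
... | inj₂ (b , ab≢0 , right) = a , b , record
  { nonzero = ab≢0
  ; aboveˣ  = λ i j a<i → zero-row {G} (above i a<i) j
  ; aboveʸ  = λ j b<j → decidable-stable (coeff G a j ℤ.≟ 0ℤ) (right j b<j)
  }

-- Leading coefficients of products

sum-zero : ∀ {n} (t : Fin n → ℤ) → (∀ i → t i ≡ 0ℤ) → sum t ≡ 0ℤ
sum-zero {n} t t≡0 = trans (sum-cong-≗ t≡0) (sum-replicate-zero n)

sum-single : ∀ {n} (t : Fin n → ℤ) k → (∀ i → i ≢ k → t i ≡ 0ℤ) → sum t ≡ t k
sum-single {suc n} t k t≡0 = begin
  sum t                                        ≡⟨ sum-remove {i = k} t ⟩
  t k ℤ.+ sum (λ i → t (punchIn k i))          ≡⟨ cong (ℤ._+_ (t k)) (sum-zero _ λ i → t≡0 _ (punchInᵢ≢i k i)) ⟩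
  t k ℤ.+ 0ℤ                                   ≡⟨ ℤ.+-identityʳ (t k) ⟩
  t k                                          ∎
  where open ≡-Reasoning

-- Stated with f on ℕ so that the index need not be computed inside Fin.
sum-toℕ-single : ∀ {n} (f : ℕ → ℤ) {k} → k ℕ.< n → (∀ i → i ≢ k → f i ≡ 0ℤ) →
                 sum {n} (f ∘ toℕ) ≡ f k
sum-toℕ-single f {k} k<n f≡0 = trans
  (sum-single (f ∘ toℕ) (fromℕ< k<n) λ i i≢k → f≡0 (toℕ i) λ i≡k →
    i≢k (toℕ-injective (trans i≡k (sym (toℕ-fromℕ< k<n)))))
  (cong f (toℕ-fromℕ< k<n))

-- Rows of `G` before `a` are paired with rows of `H` past `a′`, and rows of `G` past `a` vanish, so
-- only row `a` survives. The same argument inside that row leaves a single column.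
leading-· : ∀ {G H a b a′ b′} → Leading G a b → Leading H a′ b′ →
            coeff (G · H) (a ℕ.+ a′) (b ℕ.+ b′) ≡ coeff G a b ℤ.* coeff H a′ b′
leading-· {G} {H} {a} {b} {a′} {b′} g h = begin
  coeff (G · H) (a ℕ.+ a′) (b ℕ.+ b′)
    ≡⟨ sum-toℕ-single row (s≤s (ℕ.m≤m+n a a′)) (λ i i≢a → sum-zero {suc (b ℕ.+ b′)} _ λ j → other-row i (toℕ j) i≢a) ⟩
  row a
    ≡⟨ sum-toℕ-single (term a) (s≤s (ℕ.m≤m+n b b′)) (λ j → other-column j) ⟩
  term a b
    ≡⟨ cong₂ (λ i j → coeff G a b ℤ.* coeff H i j) (ℕ.m+n∸m≡n a a′) (ℕ.m+n∸m≡n b b′) ⟩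
  coeff G a b ℤ.* coeff H a′ b′ ∎
  where
  open ≡-Reasoning
  term : ℕ → ℕ → ℤ
  term i j = coeff G i j ℤ.* coeff H (a ℕ.+ a′ ∸ i) (b ℕ.+ b′ ∸ j)
  row : ℕ → ℤ
  row i = sum {suc (b ℕ.+ b′)} (term i ∘ toℕ)
  beyond : ∀ {m n i} → i ℕ.< m → n ℕ.< m ℕ.+ n ∸ i
  beyond {m} {n} {i} i<m = ℕ.m+n≤o⇒m≤o∸n (suc n)
    (subst (ℕ._≤ m ℕ.+ n) (cong suc (ℕ.+-comm i n)) (ℕ.+-monoˡ-≤ n i<m))
  vanishˡ : ∀ {x} y → x ≡ 0ℤ → x ℤ.* y ≡ 0ℤ
  vanishˡ y refl = refl
  vanishʳ : ∀ x {y} → y ≡ 0ℤ → x ℤ.* y ≡ 0ℤ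
  vanishʳ x refl = ℤ.*-zeroʳ x
  other-row : ∀ i j → i ≢ a → term i j ≡ 0ℤ
  other-row i j i≢a with ℕ.<-cmp i a
  ... | tri< i<a _ _ = vanishʳ (coeff G i j) (aboveˣ h _ _ (beyond i<a))
  ... | tri≈ _ i≡a _ = contradiction i≡a i≢a
  ... | tri> _ _ a<i = vanishˡ _ (aboveˣ g i j a<i)
  other-column : ∀ j → j ≢ b → term a j ≡ 0ℤ
  other-column j j≢b with ℕ.<-cmp j b
  ... | tri< j<b _ _ = vanishʳ (coeff G a j) (trans
          (cong (λ i → coeff H i (b ℕ.+ b′ ∸ j)) (ℕ.m+n∸m≡n a a′)) (aboveʸ h _ (beyond j<b)))
  ... | tri≈ _ j≡b _ = contradiction j≡b j≢b
  ... | tri> _ _ b<j = vanishˡ _ (aboveʸ g j b<j)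

-- Since ℤ has no zero divisors, the product of the leading coefficients is a nonzero coefficient of
-- `F` in row `a + a′`.
degree-bound : ∀ {F G H a b a′ b′ n} → F ≈ G · H → Leading G a b → Leading H a′ b′ →
               (∀ i j → n ℕ.< i → coeff F i j ≡ 0ℤ) → a ℕ.+ a′ ≤ n
degree-bound {F} {G} {H} {a} {b} {a′} {b′} F≈GH g h F≡0 = ℕ.≮⇒≥ λ n<a+a′ →
  let GH≡0 = trans (sym (trans (F≈GH _ _) (leading-· g h))) (F≡0 _ (b ℕ.+ b′) n<a+a′)
  in case (ℤ.i*j≡0⇒i≡0∨j≡0 (coeff G a b) GH≡0)
  where
  case : ¬ (coeff G a b ≡ 0ℤ ⊎ coeff H a′ b′ ≡ 0ℤ)
  case (inj₁ ≡0) = nonzero g ≡0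
  case (inj₂ ≡0) = nonzero h ≡0

-- Degrees in both variables

flip : ℤ[X,Y] → ℤ[X,Y]
flip G .coeff i j    = coeff G j i
flip G .bound        = bound G
flip G .boundˣ i j   = boundʸ G j i
flip G .boundʸ i j   = boundˣ G j i

flip-NonConstant : ∀ {G} → NonConstant G → NonConstant (flip G)
flip-NonConstant {G} G-nc (c , G≈c) = G-nc (c , λ
  { zero    zero    → G≈c zero zero
  ; zero    (suc j) → G≈c (suc j) zero
  ; (suc i) zero    → G≈c zero (suc i)
  ; (suc i) (suc j) → G≈c (suc j) (suc i) })

flip-· : ∀ G H → flip (G · H) ≈ flip G · flip H
flip-· G H i j = ∑-comm {suc j} {suc i} λ a b → coeff G (toℕ a) (toℕ b) ℤ.* coeff H (j ∸ toℕ a) (i ∸ toℕ b)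

-- `a` and `b` are upper bounds on the degrees, not exact degrees, so they can be enlarged later.
HasDegrees : ℤ[X,Y] → ℕ → ℕ → Set
HasDegrees G a b = (∀ i j → a ℕ.< i → coeff G i j ≡ 0ℤ) × (∀ i j → b ℕ.< j → coeff G i j ≡ 0ℤ)

constant-degrees : ∀ {G} → HasDegrees G 0 0 → G ≈ constant (coeff G 0 0)
constant-degrees (x , y) zero    zero    = refl
constant-degrees (x , y) zero    (suc j) = y 0 (suc j) (s≤s z≤n)
constant-degrees (x , y) (suc i) j       = x (suc i) j (s≤s z≤n)

-- The first exponent of the lexicographic leading monomial is the degree in X; exchanging the
-- variables gives the degree in Y. The second exponents are discarded, as each controls one row
-- only.
factor-degrees : ∀ {F G H n} → NonConstant G → NonConstant H → F ≈ G · H → HasDegrees F n n →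
  ∃₂ λ a b → ∃₂ λ a′ b′ → a ℕ.+ a′ ≤ n × b ℕ.+ b′ ≤ n × HasDegrees G a b × HasDegrees H a′ b′
factor-degrees {F} {G} {H} G-nc H-nc F≈GH (Fˣ , Fʸ) =
  let a  , _ , gˣ = leading G G-nc
      a′ , _ , hˣ = leading H H-nc
      b  , _ , gʸ = leading (flip G) (flip-NonConstant {G} G-nc)
      b′ , _ , hʸ = leading (flip H) (flip-NonConstant {H} H-nc)
  in a , b , a′ , b′ ,
     degree-bound {F} F≈GH gˣ hˣ Fˣ ,
     degree-bound {flip F} (λ i j → trans (F≈GH j i) (flip-· G H i j)) gʸ hʸ (λ i j → Fʸ j i) ,
     (aboveˣ gˣ , λ i j → aboveˣ gʸ j i) ,
     (aboveˣ hˣ , λ i j → aboveˣ hʸ j i)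

-- Congruence modulo 3

infix 4 _≡₃_
-- A record, instead of a synonym for divisibility, lets unification recover `x` and `y`.
record _≡₃_ (x y : ℤ) : Set where
  constructor mod₃
  field 3∣x-y : + 3 ∣ x ℤ.- y

≡₃-reflexive : ∀ {x y} → x ≡ y → x ≡₃ y
≡₃-reflexive {x} refl = mod₃ (divides 0ℤ (ℤ.+-inverseʳ x))

≡₃-sym : ∀ {x y} → x ≡₃ y → y ≡₃ x
≡₃-sym {x} {y} (mod₃ x≡y) = mod₃ (subst (+ 3 ∣_) (identity x y) (∣n⇒∣m*n -1ℤ x≡y))
  where
  identity : ∀ x y → -1ℤ ℤ.* (x ℤ.- y) ≡ y ℤ.- x
  identity = ℤ-Solver.solve-∀

≡₃-trans : ∀ {x y z} → x ≡₃ y → y ≡₃ z → x ≡₃ z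
≡₃-trans {x} {y} {z} (mod₃ x≡y) (mod₃ y≡z) =
  mod₃ (subst (+ 3 ∣_) (identity x y z) (∣m∣n⇒∣m+n x≡y y≡z))
  where
  identity : ∀ x y z → (x ℤ.- y) ℤ.+ (y ℤ.- z) ≡ x ℤ.- z
  identity = ℤ-Solver.solve-∀

+-cong₃ : ∀ {x x′ y y′} → x ≡₃ x′ → y ≡₃ y′ → x ℤ.+ y ≡₃ x′ ℤ.+ y′
+-cong₃ {x} {x′} {y} {y′} (mod₃ x≡x′) (mod₃ y≡y′) =
  mod₃ (subst (+ 3 ∣_) (identity x x′ y y′) (∣m∣n⇒∣m+n x≡x′ y≡y′))
  where
  identity : ∀ x x′ y y′ → (x ℤ.- x′) ℤ.+ (y ℤ.- y′) ≡ (x ℤ.+ y) ℤ.- (x′ ℤ.+ y′)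
  identity = ℤ-Solver.solve-∀

*-cong₃ : ∀ {x x′ y y′} → x ≡₃ x′ → y ≡₃ y′ → x ℤ.* y ≡₃ x′ ℤ.* y′
*-cong₃ {x} {x′} {y} {y′} (mod₃ x≡x′) (mod₃ y≡y′) =
  mod₃ (subst (+ 3 ∣_) (identity x x′ y y′) (∣m∣n⇒∣m+n (∣m⇒∣m*n y x≡x′) (∣n⇒∣m*n x′ y≡y′)))
  where
  identity : ∀ x x′ y y′ → (x ℤ.- x′) ℤ.* y ℤ.+ x′ ℤ.* (y ℤ.- y′) ≡ x ℤ.* y ℤ.- x′ ℤ.* y′
  identity = ℤ-Solver.solve-∀

sum-cong₃ : ∀ {n} {s t : Fin n → ℤ} → (∀ i → s i ≡₃ t i) → sum s ≡₃ sum t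
sum-cong₃ {zero}  s≡t = ≡₃-reflexive refl
sum-cong₃ {suc n} s≡t = +-cong₃ (s≡t 0F) (sum-cong₃ (s≡t ∘ Fin.suc))

residue : ℤ → Fin 3
residue x = fromℕ< (n%ℕd<d x 3)

-- Relates the two readings of a code, as one of 0, 1, -1 and as a remainder 0, 1, 2. They differ
-- only at `2F`, by -3.
ε-value-toℕ : ∀ r → ε-value r ≡₃ + toℕ r
ε-value-toℕ 0F = ≡₃-reflexive refl
ε-value-toℕ 1F = ≡₃-reflexive refl
ε-value-toℕ 2F = mod₃ (divides -1ℤ refl)

ε-value-residue : ∀ x → ε-value (residue x) ≡₃ x
ε-value-residue x = ≡₃-trans (ε-value-toℕ (residue x))
  (≡₃-sym (mod₃ (divides (x /ℕ 3) (begin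
    x ℤ.- + toℕ (residue x)                        ≡⟨ cong (λ r → x ℤ.- + r) (toℕ-fromℕ< (n%ℕd<d x 3)) ⟩
    x ℤ.- + (x %ℕ 3)                               ≡⟨ cong (ℤ._- + (x %ℕ 3)) (a≡a%ℕn+[a/ℕn]*n x 3) ⟩
    + (x %ℕ 3) ℤ.+ (x /ℕ 3) ℤ.* + 3 ℤ.- + (x %ℕ 3)  ≡⟨ identity (+ (x %ℕ 3)) ((x /ℕ 3) ℤ.* + 3) ⟩
    (x /ℕ 3) ℤ.* + 3                               ∎))))
  where
  open ≡-Reasoning
  identity : ∀ r q → r ℤ.+ q ℤ.- r ≡ q
  identity = ℤ-Solver.solve-∀

-- Distinct values differ by 1 or 2 up to sign, never by a multiple of 3. Hence reduction modulo 3
-- loses nothing about an outcome.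
ε-value-injective₃ : ∀ r s → ε-value r ≡₃ ε-value s → r ≡ s
ε-value-injective₃ 0F 0F _ = refl
ε-value-injective₃ 0F 1F (mod₃ d) = contradiction d (from-no (+ 3 ∣? -1ℤ))
ε-value-injective₃ 0F 2F (mod₃ d) = contradiction d (from-no (+ 3 ∣? + 1))
ε-value-injective₃ 1F 0F (mod₃ d) = contradiction d (from-no (+ 3 ∣? + 1))
ε-value-injective₃ 1F 1F _ = refl
ε-value-injective₃ 1F 2F (mod₃ d) = contradiction d (from-no (+ 3 ∣? + 2))
ε-value-injective₃ 2F 0F (mod₃ d) = contradiction d (from-no (+ 3 ∣? -1ℤ))
ε-value-injective₃ 2F 1F (mod₃ d) = contradiction d (from-no (+ 3 ∣? -[1+ 1 ]))
ε-value-injective₃ 2F 2F _ = refl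

residue-cong₃ : ∀ {x y} → x ≡₃ y → residue x ≡ residue y
residue-cong₃ {x} {y} x≡y = ε-value-injective₃ (residue x) (residue y)
  (≡₃-trans (ε-value-residue x) (≡₃-trans x≡y (≡₃-sym (ε-value-residue y))))

residue-ε-value : ∀ r → residue (ε-value r) ≡ r
residue-ε-value 0F = refl
residue-ε-value 1F = refl
residue-ε-value 2F = refl

-- Polynomials over the integers modulo 3

-- Polynomials over 𝔽₃ of degrees at most `m` in X and `k` in Y. `Ω n` is `Codes n n` by definition,
-- so outcomes and factors share one representation.
Codes : ℕ → ℕ → Set
Codes m k = Vec (Vec (Fin 3) (suc k)) (suc m)

entry : ∀ {m k} → Codes m k → ℕ → ℕ → ℤ
entry {k = k} v i j = ε-value (lookupOr 0F (lookupOr (replicate (suc k) 0F) v i) j)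

encode : ∀ m k → (ℕ → ℕ → ℤ) → Codes m k
encode m k f = tabulate λ i → tabulate λ j → residue (f (toℕ i) (toℕ j))

lookupOr-tabulate : ∀ {A : Set} {d : A} m (f : ℕ → A) → (∀ i → m ≤ i → f i ≡ d) →
                    ∀ i → lookupOr d (tabulate {n = m} (f ∘ toℕ)) i ≡ f i
lookupOr-tabulate zero    f f≡d i       = sym (f≡d i z≤n)
lookupOr-tabulate (suc m) f f≡d zero    = refl
lookupOr-tabulate (suc m) f f≡d (suc i) = lookupOr-tabulate m (f ∘ suc) (λ i m≤i → f≡d (suc i) (s≤s m≤i)) i

tabulate-replicate : ∀ {A : Set} {d : A} m (f : Fin m → A) → (∀ i → f i ≡ d) → tabulate f ≡ replicate m d
tabulate-replicate zero    f f≡d = refl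
tabulate-replicate (suc m) f f≡d = cong₂ _∷_ (f≡d 0F) (tabulate-replicate m (f ∘ Fin.suc) (f≡d ∘ Fin.suc))

tabulate-lookupOr : ∀ {A : Set} (d : A) {m} (xs : Vec A m) → tabulate (lookupOr d xs ∘ toℕ) ≡ xs
tabulate-lookupOr d []       = refl
tabulate-lookupOr d (x ∷ xs) = cong (x ∷_) (tabulate-lookupOr d xs)

-- Outside the table, lookups yield the default `0F`, the code of 0; by the degree bounds the
-- coefficients of `G` vanish there as well.
entry-encode : ∀ {G m k} → HasDegrees G m k → ∀ i j → entry (encode m k (coeff G)) i j ≡₃ coeff G i j
entry-encode {G} {m} {k} (Gˣ , Gʸ) i j = subst (_≡₃ coeff G i j) (sym (cong ε-value (begin
  lookupOr 0F (lookupOr (replicate (suc k) 0F) (encode m k (coeff G)) i) j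
    ≡⟨ cong (λ row → lookupOr 0F row j) (lookupOr-tabulate (suc m) row (λ i m<i →
         tabulate-replicate (suc k) _ λ j → cong residue (Gˣ i (toℕ j) m<i)) i) ⟩
  lookupOr 0F (row i) j
    ≡⟨ lookupOr-tabulate (suc k) (λ j → residue (coeff G i j)) (λ j k<j → cong residue (Gʸ i j k<j)) j ⟩
  residue (coeff G i j) ∎))) (ε-value-residue (coeff G i j))
  where
  open ≡-Reasoning
  row : ℕ → Vec (Fin 3) (suc k)
  row i = tabulate λ j → residue (coeff G i (toℕ j))

encode-entry : ∀ {m k} (v : Codes m k) → encode m k (entry v) ≡ v
encode-entry {m} {k} v = begin
  encode m k (entry v)
    ≡⟨ tabulate-cong (λ i → tabulate-cong λ j → residue-ε-value (lookupOr 0F (row i) (toℕ j))) ⟩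
  tabulate (λ i → tabulate (lookupOr 0F (row i) ∘ toℕ))
    ≡⟨ tabulate-cong (λ i → tabulate-lookupOr 0F (row i)) ⟩
  tabulate row
    ≡⟨ tabulate-lookupOr _ v ⟩
  v ∎
  where
  open ≡-Reasoning
  row : Fin (suc m) → Vec (Fin 3) (suc k)
  row i = lookupOr (replicate (suc k) 0F) v (toℕ i)

encode-cong₃ : ∀ {m k} {f g : ℕ → ℕ → ℤ} → (∀ i j → f i j ≡₃ g i j) → encode m k f ≡ encode m k g
encode-cong₃ f≡g = tabulate-cong λ i → tabulate-cong λ j → residue-cong₃ (f≡g (toℕ i) (toℕ j))

-- The coefficient formula of `_·_` on bare functions, so that it applies to `entry` directly;
-- `coeff (G · H)` unfolds to it.
convolution : (ℕ → ℕ → ℤ) → (ℕ → ℕ → ℤ) → ℕ → ℕ → ℤ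
convolution g h i j = sum {suc i} λ a → sum {suc j} λ b → g (toℕ a) (toℕ b) ℤ.* h (i ∸ toℕ a) (j ∸ toℕ b)

convolution-cong₃ : ∀ {g g′ h h′} → (∀ i j → g i j ≡₃ g′ i j) → (∀ i j → h i j ≡₃ h′ i j) →
                    ∀ i j → convolution g h i j ≡₃ convolution g′ h′ i j
convolution-cong₃ g≡g′ h≡h′ i j = sum-cong₃ {suc i} λ a → sum-cong₃ {suc j} λ b →
  *-cong₃ (g≡g′ (toℕ a) (toℕ b)) (h≡h′ (i ∸ toℕ a) (j ∸ toℕ b))

mulCodes : ∀ n a b → Codes a b → Codes (n ∸ a) (n ∸ b) → Ω n
mulCodes n a b g h = encode n n (convolution (entry g) (entry h))

-- Reduction modulo 3 respects products and is injective on outcomes, so `ω` is recovered from the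
-- reduced factors.
factor-codes : ∀ {n} (ω : Ω n) {G H a b} → polynomial ω ≈ G · H →
               HasDegrees G a b → HasDegrees H (n ∸ a) (n ∸ b) →
               ω ≡ mulCodes n a b (encode a b (coeff G)) (encode (n ∸ a) (n ∸ b) (coeff H))
factor-codes {n} ω {G} {H} {a} {b} ω≈GH G-deg H-deg = begin
  ω                                            ≡⟨ encode-entry ω ⟨
  -- `coeff (polynomial ω)` unfolds to `entry ω`.
  encode n n (entry ω)                         ≡⟨ encode-cong₃ (λ i j → ≡₃-reflexive (ω≈GH i j)) ⟩
  encode n n (convolution (coeff G) (coeff H)) ≡⟨ encode-cong₃ (convolution-cong₃
      (λ i j → ≡₃-sym (entry-encode {G} G-deg i j))
      (λ i j → ≡₃-sym (entry-encode {H} H-deg i j))) ⟩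
  mulCodes n a b g h ∎
  where
  open ≡-Reasoning
  g = encode a b (coeff G)
  h = encode (n ∸ a) (n ∸ b) (coeff H)

-- Counting products of a given shape

-- Delete one occurrence of the head from `ys`; the later entries of `xs` differ from the head and
-- so remain.
Unique-⊆-length : ∀ {A : Set} {xs ys : List A} → Unique xs → (∀ {x} → x ∈ xs → x ∈ ys) → length xs ≤ length ys
Unique-⊆-length {xs = List.[]} _ _ = z≤n
Unique-⊆-length {xs = x List.∷ xs} {ys} (x∉xs ∷ᵘ xs!) xs⊆ys with ∈-∃++ (xs⊆ys (here refl))
... | as , bs , refl = subst (suc (length xs) ≤_) (sym (length-++-sucʳ as x bs)) (s≤s (Unique-⊆-length xs! rest))
  where
  rest : ∀ {z} → z ∈ xs → z ∈ as ++ bs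
  rest z∈xs with ∈-++⁻ as (xs⊆ys (there z∈xs))
  ... | inj₁ z∈as         = ∈-++⁺ˡ z∈as
  ... | inj₂ (here refl)  = contradiction refl (All.lookup x∉xs z∈xs)
  ... | inj₂ (there z∈bs) = ∈-++⁺ʳ as z∈bs

length-cartesianProductWith : ∀ {A B C : Set} (f : A → B → C) xs ys →
                              length (cartesianProductWith f xs ys) ≡ length xs ℕ.* length ys
length-cartesianProductWith f List.[]       ys = refl
length-cartesianProductWith f (x List.∷ xs) ys = trans (length-++ (map (f x) ys))
  (cong₂ ℕ._+_ (length-map (f x) ys) (length-cartesianProductWith f xs ys))

-- The factor `c` keeps the count free of division; it becomes `3 ^ n`.
length-concatMap-≤ : ∀ {A B : Set} (f : A → List B) {c d} xs → (∀ {x} → x ∈ xs → length (f x) ℕ.* c ≤ d) →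
                     length (concatMap f xs) ℕ.* c ≤ length xs ℕ.* d
length-concatMap-≤ f List.[] _ = z≤n
length-concatMap-≤ f {c} {d} (x List.∷ xs) f≤ = begin
  length (f x ++ concatMap f xs) ℕ.* c                   ≡⟨ cong (ℕ._* c) (length-++ (f x)) ⟩
  (length (f x) ℕ.+ length (concatMap f xs)) ℕ.* c       ≡⟨ ℕ.*-distribʳ-+ c (length (f x)) _ ⟩
  length (f x) ℕ.* c ℕ.+ length (concatMap f xs) ℕ.* c
    ≤⟨ ℕ.+-mono-≤ (f≤ (here refl)) (length-concatMap-≤ f xs (f≤ ∘ there)) ⟩
  d ℕ.+ length xs ℕ.* d ∎
  where open ℕ.≤-Reasoning

vectors : ∀ {A : Set} → List A → ∀ m → List (Vec A m)
vectors xs zero    = [] List.∷ List.[]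
vectors xs (suc m) = cartesianProductWith _∷_ xs (vectors xs m)

∈-vectors : ∀ {A : Set} {xs : List A} → (∀ x → x ∈ xs) → ∀ {m} (v : Vec A m) → v ∈ vectors xs m
∈-vectors x∈xs []      = here refl
∈-vectors x∈xs (x ∷ v) = ∈-cartesianProductWith⁺ _∷_ (x∈xs x) (∈-vectors x∈xs v)

length-vectors : ∀ {A : Set} (xs : List A) m → length (vectors xs m) ≡ length xs ^ m
length-vectors xs zero    = refl
length-vectors xs (suc m) = trans (length-cartesianProductWith _∷_ xs (vectors xs m))
  (cong (length xs ℕ.*_) (length-vectors xs m))

allCodes : ∀ m k → List (Codes m k)
allCodes m k = vectors (vectors (allFin 3) (suc k)) (suc m)

∈-allCodes : ∀ {m k} (v : Codes m k) → v ∈ allCodes m k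
∈-allCodes = ∈-vectors (∈-vectors ∈-allFin)

length-allCodes : ∀ m k → length (allCodes m k) ≡ 3 ^ (suc k ℕ.* suc m)
length-allCodes m k = begin
  length (allCodes m k)                         ≡⟨ length-vectors (vectors (allFin 3) (suc k)) (suc m) ⟩
  length (vectors (allFin 3) (suc k)) ^ suc m   ≡⟨ cong (_^ suc m) (length-vectors (allFin 3) (suc k)) ⟩
  (3 ^ suc k) ^ suc m                           ≡⟨ ℕ.^-*-assoc 3 (suc k) (suc m) ⟩
  3 ^ (suc k ℕ.* suc m)                         ∎
  where open ≡-Reasoning

-- Repetitions are harmless, since the length serves only as an upper bound.
products : ∀ n → ℕ × ℕ → List (Ω n)
products n (a , b) = cartesianProductWith (mulCodes n a b) (allCodes a b) (allCodes (n ∸ a) (n ∸ b))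

-- Expanding (a+a′+1)(b+b′+1) produces both code sizes less one, plus the cross terms ab′ + a′b,
-- which are at least n.
exponent-bound : ∀ {n} a a′ b b′ → a ℕ.+ a′ ≡ n → b ℕ.+ b′ ≡ n → n ≤ a ℕ.* b′ ℕ.+ a′ ℕ.* b →
                 suc b ℕ.* suc a ℕ.+ suc b′ ℕ.* suc a′ ℕ.+ n ≤ suc (suc n ℕ.* suc n)
exponent-bound {n} a a′ b b′ a+a′≡n b+b′≡n spread = begin
  suc b ℕ.* suc a ℕ.+ suc b′ ℕ.* suc a′ ℕ.+ n                           ≤⟨ ℕ.+-monoʳ-≤ _ spread ⟩
  suc b ℕ.* suc a ℕ.+ suc b′ ℕ.* suc a′ ℕ.+ (a ℕ.* b′ ℕ.+ a′ ℕ.* b)   ≡⟨ identity a a′ b b′ ⟩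
  suc (suc (a ℕ.+ a′) ℕ.* suc (b ℕ.+ b′))                             ≡⟨ cong₂ (λ x y → suc (suc x ℕ.* suc y)) a+a′≡n b+b′≡n ⟩
  suc (suc n ℕ.* suc n)                                                 ∎
  where
  open ℕ.≤-Reasoning
  identity : ∀ a a′ b b′ → suc b ℕ.* suc a ℕ.+ suc b′ ℕ.* suc a′ ℕ.+ (a ℕ.* b′ ℕ.+ a′ ℕ.* b)
                         ≡ suc (suc (a ℕ.+ a′) ℕ.* suc (b ℕ.+ b′))
  identity = ℕ-Solver.solve-∀

-- The cross terms are what the exponent of the product count falls short of (n+1)² + 1. For
-- positive `n` the condition fails at the corners (0, 0) and (n, n).
Spread : ℕ → ℕ × ℕ → Set
Spread n (a , b) = n ≤ a ℕ.* (n ∸ b) ℕ.+ (n ∸ a) ℕ.* b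

Spread? : ∀ n → Decidable (Spread n)
Spread? n (a , b) = n ℕ.≤? a ℕ.* (n ∸ b) ℕ.+ (n ∸ a) ℕ.* b

length-products : ∀ {n a b} → a ≤ n → b ≤ n → Spread n (a , b) →
                  length (products n (a , b)) ℕ.* 3 ^ n ≤ 3 ^ suc (suc n ℕ.* suc n)
length-products {n} {a} {b} a≤n b≤n spread = begin
  length (products n (a , b)) ℕ.* 3 ^ n
    ≡⟨ cong (ℕ._* 3 ^ n) (length-cartesianProductWith (mulCodes n a b) (allCodes a b) (allCodes (n ∸ a) (n ∸ b))) ⟩
  length (allCodes a b) ℕ.* length (allCodes (n ∸ a) (n ∸ b)) ℕ.* 3 ^ n
    ≡⟨ cong (ℕ._* 3 ^ n) (cong₂ ℕ._*_ (length-allCodes a b) (length-allCodes (n ∸ a) (n ∸ b))) ⟩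
  3 ^ x ℕ.* 3 ^ y ℕ.* 3 ^ n   ≡⟨ cong (ℕ._* 3 ^ n) (ℕ.^-distribˡ-+-* 3 x y) ⟨
  3 ^ (x ℕ.+ y) ℕ.* 3 ^ n     ≡⟨ ℕ.^-distribˡ-+-* 3 (x ℕ.+ y) n ⟨
  3 ^ (x ℕ.+ y ℕ.+ n)
    ≤⟨ ℕ.^-monoʳ-≤ 3 (exponent-bound a (n ∸ a) b (n ∸ b) (ℕ.m+[n∸m]≡n a≤n) (ℕ.m+[n∸m]≡n b≤n) spread) ⟩
  3 ^ suc (suc n ℕ.* suc n)   ∎
  where
  open ℕ.≤-Reasoning
  x = suc b ℕ.* suc a
  y = suc (n ∸ b) ℕ.* suc (n ∸ a)

shapes : ℕ → List (ℕ × ℕ)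
shapes n = filter (Spread? n) (cartesianProduct (upTo (suc n)) (upTo (suc n)))

∈-shapes⁺ : ∀ {n a b} → a ≤ n → b ≤ n → Spread n (a , b) → (a , b) ∈ shapes n
∈-shapes⁺ {n} a≤n b≤n spread =
  ∈-filter⁺ (Spread? n) (∈-cartesianProduct⁺ (∈-upTo⁺ (s≤s a≤n)) (∈-upTo⁺ (s≤s b≤n))) spread

∈-shapes⁻ : ∀ {n a b} → (a , b) ∈ shapes n → a ≤ n × b ≤ n × Spread n (a , b)
∈-shapes⁻ {n} ab∈ =
  let ab∈² , spread = ∈-filter⁻ (Spread? n) {xs = cartesianProduct (upTo (suc n)) (upTo (suc n))} ab∈
      a∈ , b∈ = ∈-cartesianProduct⁻ (upTo (suc n)) (upTo (suc n)) ab∈²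
  in ℕ.≤-pred (∈-upTo⁻ a∈) , ℕ.≤-pred (∈-upTo⁻ b∈) , spread

length-shapes : ∀ n → length (shapes n) ≤ suc n ℕ.* suc n
length-shapes n = begin
  length (shapes n)
    ≤⟨ length-filter (Spread? n) (cartesianProduct (upTo (suc n)) (upTo (suc n))) ⟩
  length (cartesianProduct (upTo (suc n)) (upTo (suc n)))
    ≡⟨ length-cartesianProductWith _,_ (upTo (suc n)) (upTo (suc n)) ⟩
  length (upTo (suc n)) ℕ.* length (upTo (suc n))
    ≡⟨ cong₂ ℕ._*_ (length-upTo (suc n)) (length-upTo (suc n)) ⟩
  suc n ℕ.* suc n ∎
  where open ℕ.≤-Reasoning

allProducts : ∀ n → List (Ω n)
allProducts n = concatMap (products n) (shapes n)

length-allProducts : ∀ n → length (allProducts n) ℕ.* 3 ^ n ≤ suc n ℕ.* suc n ℕ.* 3 ^ suc (suc n ℕ.* suc n)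
length-allProducts n = ℕ.≤-trans
  (length-concatMap-≤ (products n) (shapes n) λ ab∈ →
    let a≤n , b≤n , spread = ∈-shapes⁻ ab∈ in length-products a≤n b≤n spread)
  (ℕ.*-monoˡ-≤ (3 ^ suc (suc n ℕ.* suc n)) (length-shapes n))

-- Reducible outcomes are listed products

spread-off-corners : ∀ {n} a a′ b b′ → a ℕ.+ a′ ≡ n → b ℕ.+ b′ ≡ n →
                     ¬ (a ≡ 0 × b ≡ 0) → ¬ (a′ ≡ 0 × b′ ≡ 0) → n ≤ a ℕ.* b′ ℕ.+ a′ ℕ.* b
spread-off-corners zero a′ zero b′ _ _ ab≢0 _ = contradiction (refl , refl) ab≢0
-- Here a′ = n and b is positive, so a′b alone reaches n. The case a′ = 0 uses ab′ in the same way.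
spread-off-corners zero a′ (suc b) b′ refl _ _ _ = ℕ.m≤m*n a′ (suc b)
spread-off-corners (suc a) zero b zero _ _ _ a′b′≢0 = contradiction (refl , refl) a′b′≢0
spread-off-corners (suc a) zero b (suc b′) refl _ _ _ =
  ℕ.≤-trans (ℕ.≤-reflexive (ℕ.+-identityʳ (suc a)))
    (ℕ.≤-trans (ℕ.m≤m*n (suc a) (suc b′)) (ℕ.m≤m+n _ 0))
-- With both a and a′ positive, ab′ ≥ b′ and a′b ≥ b, and b + b′ = n.
spread-off-corners (suc a) (suc a′) b b′ _ refl _ _ =
  ℕ.≤-trans (ℕ.≤-reflexive (ℕ.+-comm b b′)) (ℕ.+-mono-≤ (ℕ.m≤n*m b′ (suc a)) (ℕ.m≤n*m b (suc a′)))

HasDegrees-mono : ∀ {G a b c d} → a ≤ c → b ≤ d → HasDegrees G a b → HasDegrees G c d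
HasDegrees-mono a≤c b≤d (Gˣ , Gʸ) =
  (λ i j c<i → Gˣ i j (ℕ.≤-<-trans a≤c c<i)) , (λ i j d<j → Gʸ i j (ℕ.≤-<-trans b≤d d<j))

NonConstant-degrees : ∀ {G a b} → NonConstant G → HasDegrees G a b → ¬ (a ≡ 0 × b ≡ 0)
NonConstant-degrees {G} G-nc G-deg (refl , refl) = G-nc (coeff G 0 0 , constant-degrees {G} G-deg)

Reducible⇒∈-allProducts : ∀ {n} (ω : Ω n) → Reducible (polynomial ω) → ω ∈ allProducts n
Reducible⇒∈-allProducts {n} ω (G , H , G-nc , H-nc , ω≈GH) =
  let a , b , a′ , b′ , a+a′≤n , b+b′≤n , G-deg , H-deg =
        factor-degrees {polynomial ω} {G} {H} G-nc H-nc ω≈GH (boundˣ (polynomial ω) , boundʸ (polynomial ω))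
      -- Enlarging the bounds for `H` to the complementary ones makes the pair (a, b) determine the
      -- whole shape.
      H-deg′ = HasDegrees-mono {H} (a′≤n∸a a+a′≤n) (a′≤n∸a b+b′≤n) H-deg
      a≤n = ℕ.m+n≤o⇒m≤o a a+a′≤n
      b≤n = ℕ.m+n≤o⇒m≤o b b+b′≤n
      spread = spread-off-corners a (n ∸ a) b (n ∸ b) (ℕ.m+[n∸m]≡n a≤n) (ℕ.m+[n∸m]≡n b≤n)
        (NonConstant-degrees {G} G-nc G-deg) (NonConstant-degrees {H} H-nc H-deg′)
  in ∈-concatMap⁺ (products n) (lose (∈-shapes⁺ a≤n b≤n spread)
       (subst (_∈ products n (a , b)) (sym (factor-codes ω {G} {H} ω≈GH G-deg H-deg′))
         (∈-cartesianProductWith⁺ (mulCodes n a b) (∈-allCodes (encode a b (coeff G)))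
           (∈-allCodes (encode (n ∸ a) (n ∸ b) (coeff H))))))
  where
  a′≤n∸a : ∀ {a a′} → a ℕ.+ a′ ≤ n → a′ ≤ n ∸ a
  a′≤n∸a {a} {a′} a+a′≤n = ℕ.m+n≤o⇒m≤o∸n a′ (subst (_≤ n) (ℕ.+-comm a a′) a+a′≤n)

-- Decay of the bound and the limit

cube≤3^ : ∀ k → (3 ℕ.+ k) ℕ.* (3 ℕ.+ k) ℕ.* (3 ℕ.+ k) ≤ 3 ^ (3 ℕ.+ k)
cube≤3^ zero    = ℕ.≤-refl
cube≤3^ (suc k) = begin
  (4 ℕ.+ k) ℕ.* (4 ℕ.+ k) ℕ.* (4 ℕ.+ k)
    -- The added polynomial is 3(3+k)³ - (4+k)³, whose coefficients are all nonnegative.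
    ≤⟨ ℕ.m≤m+n _ (17 ℕ.+ 33 ℕ.* k ℕ.+ 15 ℕ.* (k ℕ.* k) ℕ.+ 2 ℕ.* (k ℕ.* k ℕ.* k)) ⟩
  (4 ℕ.+ k) ℕ.* (4 ℕ.+ k) ℕ.* (4 ℕ.+ k) ℕ.+ (17 ℕ.+ 33 ℕ.* k ℕ.+ 15 ℕ.* (k ℕ.* k) ℕ.+ 2 ℕ.* (k ℕ.* k ℕ.* k))
    ≡⟨ identity k ⟩
  3 ℕ.* ((3 ℕ.+ k) ℕ.* (3 ℕ.+ k) ℕ.* (3 ℕ.+ k))
    ≤⟨ ℕ.*-monoʳ-≤ 3 (cube≤3^ k) ⟩
  3 ^ (4 ℕ.+ k) ∎
  where
  open ℕ.≤-Reasoning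
  identity : ∀ k → (4 ℕ.+ k) ℕ.* (4 ℕ.+ k) ℕ.* (4 ℕ.+ k)
                     ℕ.+ (17 ℕ.+ 33 ℕ.* k ℕ.+ 15 ℕ.* (k ℕ.* k) ℕ.+ 2 ℕ.* (k ℕ.* k ℕ.* k))
                 ≡ 3 ℕ.* ((3 ℕ.+ k) ℕ.* (3 ℕ.+ k) ℕ.* (3 ℕ.+ k))
  identity = ℕ-Solver.solve-∀

-- Apply (n+1)³ ≤ 3 · 3^n and cancel (n+1)². One factor 3 of the 9 comes from this inequality, the
-- other from the hypothesis.
linear-decay : ∀ c m {n} → 2 ≤ n → c ℕ.* 3 ^ n ≤ suc n ℕ.* suc n ℕ.* (3 ℕ.* m) → c ℕ.* suc n ≤ 9 ℕ.* m
linear-decay c m {suc (suc k)} (s≤s (s≤s z≤n)) c≤ = ℕ.*-cancelˡ-≤ (s ℕ.* s) (begin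
  s ℕ.* s ℕ.* (c ℕ.* s)          ≡⟨ left s c ⟩
  c ℕ.* (s ℕ.* s ℕ.* s)          ≤⟨ ℕ.*-monoʳ-≤ c (cube≤3^ k) ⟩
  c ℕ.* (3 ℕ.* 3 ^ (2 ℕ.+ k))    ≡⟨ middle c (3 ^ (2 ℕ.+ k)) ⟩
  3 ℕ.* (c ℕ.* 3 ^ (2 ℕ.+ k))    ≤⟨ ℕ.*-monoʳ-≤ 3 c≤ ⟩
  3 ℕ.* (s ℕ.* s ℕ.* (3 ℕ.* m))  ≡⟨ right s m ⟩
  s ℕ.* s ℕ.* (9 ℕ.* m)          ∎)
  where
  open ℕ.≤-Reasoning
  s = 3 ℕ.+ k
  left : ∀ s c → s ℕ.* s ℕ.* (c ℕ.* s) ≡ c ℕ.* (s ℕ.* s ℕ.* s)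
  left = ℕ-Solver.solve-∀
  middle : ∀ c t → c ℕ.* (3 ℕ.* t) ≡ 3 ℕ.* (c ℕ.* t)
  middle = ℕ-Solver.solve-∀
  right : ∀ s m → 3 ℕ.* (s ℕ.* s ℕ.* (3 ℕ.* m)) ≡ s ℕ.* s ℕ.* (9 ℕ.* m)
  right = ℕ-Solver.solve-∀

scaled-< : ∀ c d {m n} → 0 ℕ.< m → 9 ℕ.* d ≤ n → c ℕ.* suc n ≤ 9 ℕ.* m → c ℕ.* d ℕ.< m
-- Strictness comes from `0 < m` here, and from `9 * d < suc n` when `c` is positive.
scaled-< zero    d 0<m _ _ = 0<m
scaled-< (suc c) d {m} {n} _ 9d≤n c≤ = ℕ.*-cancelˡ-< 9 (suc c ℕ.* d) m (begin-strict
  9 ℕ.* (suc c ℕ.* d)    ≡⟨ identity (suc c) d ⟩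
  suc c ℕ.* (9 ℕ.* d)    <⟨ ℕ.*-monoʳ-< (suc c) (s≤s 9d≤n) ⟩
  suc c ℕ.* suc n        ≤⟨ c≤ ⟩
  9 ℕ.* m                ∎)
  where
  open ℕ.≤-Reasoning
  identity : ∀ c d → 9 ℕ.* (c ℕ.* d) ≡ c ℕ.* (9 ℕ.* d)
  identity = ℕ-Solver.solve-∀

-- A positive rational has numerator at least 1, so it is at least the reciprocal of its
-- denominator, and c/m lies below that.
fraction-< : ∀ {δ} → 0ℚ < δ → ∀ c m .{{_ : ℕ.NonZero m}} → c ℕ.* ↧ₙ δ ℕ.< m → ∣ + c / m - 0ℚ ∣ < δ
fraction-< {δ@(mkℚ (+ suc k) d _)} 0<δ c (suc m) cd<m =
  subst (_< δ) (sym (trans (cong ∣_∣ (ℚ.+-identityʳ (+ c / suc m))) (ℚ.0≤p⇒∣p∣≡p 0≤p)))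
    (ℚ.toℚᵘ-cancel-< (ℚᵘ.<-respˡ-≃ (ℚᵘ.≃-sym (ℚ.toℚᵘ-fromℚᵘ (ℚᵘ.mkℚᵘ (+ c) m)))
      (ℚᵘ.*<* (subst₂ ℤ._<_ (ℤ.pos-* c (suc d)) (ℤ.pos-* (suc k) (suc m))
        (ℤ.+<+ (ℕ.<-≤-trans cd<m (ℕ.m≤n*m (suc m) (suc k))))))))
  where
  0≤p : 0ℚ Data.Rational.≤ + c / suc m
  0≤p = ℚ.nonNegative⁻¹ _ {{ℚ.normalize-nonNeg c (suc m)}}
fraction-< {mkℚ (+ zero) d _}   (*<* (ℤ.+<+ ()))
fraction-< {mkℚ (-[1+ k ]) d _} (*<* ())

theorem3p1 : ∀ (δ : ℚ) → 0ℚ < δ →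
    ∃[ N ] ∀ (n : ℕ) → N ≤ n →
    ∀ (p : ℚ) → HasProbability n (λ ω → Reducible (polynomial ω)) p → ∣ p - 0ℚ ∣ < δ
-- The 2 gives n + 1 ≥ 3 for the cubic estimate; nine times the denominator of δ absorbs the
-- constant 9 of `linear-decay`.
theorem3p1 δ 0<δ = 2 ℕ.+ 9 ℕ.* ↧ₙ δ , λ where
  n N≤n _ (outcomes , outcomes! , outcomes⇔ , refl) →
    let c = length outcomes
        c≤ = Unique-⊆-length outcomes! λ {ω} ω∈ →
          Reducible⇒∈-allProducts ω (Equivalence.to (outcomes⇔ ω) ω∈)
        decay = linear-decay c (3 ^ (suc n ℕ.* suc n)) (ℕ.m+n≤o⇒m≤o 2 N≤n)
          (ℕ.≤-trans (ℕ.*-monoˡ-≤ (3 ^ n) c≤) (length-allProducts n))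
    in fraction-< 0<δ c (3 ^ (suc n ℕ.* suc n)) {{ℕ.m^n≢0 3 (suc n ℕ.* suc n)}}
         (scaled-< c (↧ₙ δ) (ℕ.m^n>0 3 (suc n ℕ.* suc n)) (ℕ.m+n≤o⇒n≤o 2 N≤n) decay)
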